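{- Let $G$ be a graph and $u\in V(G)$. Let $H$ be the graph obtained from $G$ by attaching a true twin $u'$ to $u$, i.e. by adding a new vertex $u'$ whose neighbors are exactly the vertices of $N_G[u]$. Then $\gamma_I(H)=\gamma_I(G)$ or $\gamma_I(H)=\gamma_I(G)+1$.
   Context: All graphs are finite, simple and undirected. $N(v)$ denotes the open neighborhood of a vertex $v$ and $N[v]=N(v)\cup\{v\}$ its closed neighborhood. An Italian dominating function (IDF) of a graph $G$ is a function $f:V(G)\to\{0,1,2\}$ such that every $v\in V(G)$ with $f(v)=0$ satisfies $\sum_{u\in N(v)}f(u)\ge 2$. Its weight is $\sum_{v\in V(G)}f(v)$, and the Italian domination number $\gamma_I(G)$ is the minimum weight of an IDF of $G$. -}

module Defs where

open import Level using (0ℓ)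
open import Data.Bool.Base using (if_then_else_)
open import Data.Empty using (⊥)
open import Data.Fin.Base using (Fin; zero; suc; toℕ; funToFin; finToFun)
import Data.Fin.Properties as Fin
open import Data.Nat.Base using (ℕ; zero; suc; _≤_; z≤n; s≤s)
import Data.Nat.Properties as ℕ
open import Data.Product.Base using (∃; _×_; _,_; proj₁; proj₂)
open import Data.Sum.Base using (_⊎_)
open import Relation.Binary.Core using (Rel)
open import Relation.Binary.Definitions using (Symmetric; Irreflexive; Decidable)
open import Relation.Binary.PropositionalEquality using (_≡_; _≗_; refl; sym; trans; cong; subst)
open import Relation.Nullary.Decidable using (yes; no; does; map′; _×-dec_; _→-dec_; _⊎-dec_)
open import Relation.Nullary.Negation using (contradiction)
open import Relation.Unary using (Pred)
import Relation.Unary as U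
open import Algebra.Properties.CommutativeMonoid.Sum ℕ.+-0-commutativeMonoid using (sum; sum-cong-≗)

record Graph (n : ℕ) : Set₁ where
  field
    Adj    : Rel (Fin n) 0ℓ
    adj?   : Decidable Adj
    symm   : Symmetric Adj
    irrefl : Irreflexive _≡_ Adj

open Graph public

N : ∀ {n} → Graph n → Fin n → Pred (Fin n) 0ℓ
N G v w = Adj G v w

N[] : ∀ {n} → Graph n → Fin n → Pred (Fin n) 0ℓ
N[] G v w = N G v w ⊎ w ≡ v

-- The new vertex u′ is zero; the vertex i of G becomes suc i.
module _ {n} (G : Graph n) (u : Fin n) where

  TwinAdj : Rel (Fin (suc n)) 0ℓ
  TwinAdj zero    zero    = ⊥
  TwinAdj zero    (suc j) = N[] G u j
  TwinAdj (suc i) zero    = N[] G u i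
  TwinAdj (suc i) (suc j) = Adj G i j

  N[]? : U.Decidable (N[] G u)
  N[]? w = adj? G u w ⊎-dec (w Fin.≟ u)

  twinAdj? : Decidable TwinAdj
  twinAdj? zero    zero    = no λ ()
  twinAdj? zero    (suc j) = N[]? j
  twinAdj? (suc i) zero    = N[]? i
  twinAdj? (suc i) (suc j) = adj? G i j

  twinSymm : Symmetric TwinAdj
  twinSymm {zero}  {suc j} p = p
  twinSymm {suc i} {zero}  p = p
  twinSymm {suc i} {suc j} p = symm G p

  twinIrrefl : Irreflexive _≡_ TwinAdj
  twinIrrefl {suc i} refl p = irrefl G refl p

  attachTrueTwin : Graph (suc n)
  attachTrueTwin = record
    { Adj = TwinAdj ; adj? = twinAdj? ; symm = λ {i j} → twinSymm {i} {j} ; irrefl = twinIrrefl }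

Labelling : ℕ → Set
Labelling n = Fin n → Fin 3

weight : ∀ {n} → Labelling n → ℕ
weight f = sum (λ v → toℕ (f v))

neighbourhoodSum : ∀ {n} → Graph n → Labelling n → Fin n → ℕ
neighbourhoodSum G f v = sum (λ w → if does (adj? G v w) then toℕ (f w) else 0)

IsIDF : ∀ {n} → Graph n → Labelling n → Set
IsIDF G f = ∀ v → f v ≡ zero → 2 ≤ neighbourhoodSum G f v

IsIDFWeight : ∀ {n} → Graph n → ℕ → Set
IsIDFWeight G k = ∃ λ f → IsIDF G f × weight f ≡ k

IsMinimum : Pred ℕ 0ℓ → ℕ → Set
IsMinimum P k = P k × (∀ j → P j → k ≤ j)

minimum : (P : Pred ℕ 0ℓ) → U.Decidable P → ∀ m → P m → ∃ (IsMinimum P)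
minimum P P? m Pm with P? 0
... | yes P0 = 0 , P0 , λ _ _ → z≤n
minimum P P? zero    Pm | no ¬P0 = contradiction Pm ¬P0
minimum P P? (suc m) Pm | no ¬P0 with minimum (λ j → P (suc j)) (λ j → P? (suc j)) m Pm
... | k , Pk , least = suc k , Pk , λ where
  zero    P0 → contradiction P0 ¬P0
  (suc j) Pj → s≤s (least j Pj)

module _ {n} (G : Graph n) where

  isIDF? : U.Decidable (IsIDF G)
  isIDF? f = Fin.all? λ v → (f v Fin.≟ zero) →-dec (2 ℕ.≤? neighbourhoodSum G f v)

  weight-cong : ∀ {f g : Labelling n} → f ≗ g → weight f ≡ weight g
  weight-cong f≗g = sum-cong-≗ (λ v → cong toℕ (f≗g v))

  isIDF-resp : ∀ {f g} → f ≗ g → IsIDF G f → IsIDF G g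
  isIDF-resp f≗g idf v gv≡0 = subst (2 ≤_)
    (sum-cong-≗ (λ w → cong (λ x → if does (adj? G v w) then toℕ x else 0) (f≗g w)))
    (idf v (trans (f≗g v) gv≡0))

  isIDFWeight? : U.Decidable (IsIDFWeight G)
  isIDFWeight? k = map′
    (λ (i , p) → finToFun i , p)
    (λ (f , idf , eq) → funToFin f ,
      isIDF-resp (λ v → sym (Fin.finToFun-funToFin f v)) idf ,
      trans (weight-cong (Fin.finToFun-funToFin f)) eq)
    (Fin.any? λ i → isIDF? (finToFun i) ×-dec (weight {n} (finToFun i) ℕ.≟ k))

  minimumIDFWeight : ∃ (IsMinimum (IsIDFWeight G))
  minimumIDFWeight = minimum (IsIDFWeight G) isIDFWeight? _
    ((λ _ → suc (suc zero)) , (λ _ ()) , refl)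

  γI : ℕ
  γI = proj₁ minimumIDFWeight

  γI-isMinimum : IsMinimum (IsIDFWeight G) γI
  γI-isMinimum = proj₂ minimumIDFWeight

{-# OPTIONS --safe #-}

-- Extending an IDF of G by the label 1 at u′ gives an IDF of H, so γI H ≤ γI G + 1.
-- Conversely, an IDF h of H yields one of G of no larger weight by moving the label
-- of u′ onto u, truncating at 2: every neighbour of u in G sees both u and u′ in H, so
-- either it keeps its neighbourhood sum or it sees a label 2 at u.

module Submission where

open import Defs
open import Data.Bool.Base using (if_then_else_; true; false)
open import Data.Nat.Base using (ℕ; zero; suc; _+_; _≤_; z≤n; s≤s)
open import Data.Nat.Properties
open import Data.Fin.Base using (Fin; zero; suc; toℕ)
import Data.Fin.Properties as Fin
open import Data.Product.Base using (∃-syntax; _×_; _,_; proj₂)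
open import Data.Sum.Base using (_⊎_; inj₁; inj₂)
open import Data.Vec.Functional using (Vector; removeAt; updateAt; _∷_)
open import Data.Vec.Functional.Properties using (updateAt-updates; updateAt-minimal)
open import Function.Base using (_∘_)
open import Relation.Binary.PropositionalEquality using (_≡_; _≢_; refl; sym; trans; cong; subst)
open import Relation.Nullary.Decidable using (yes; no; does; dec-false)
open import Relation.Nullary.Negation using (¬_; contradiction)
open import Algebra.Properties.CommutativeMonoid.Sum +-0-commutativeMonoid using (sum; sum-cong-≗; sum-remove)

if-else-0-≤ : ∀ b m → (if b then m else 0) ≤ m
if-else-0-≤ true  m = ≤-refl
if-else-0-≤ false m = z≤n

if-then-0-else-0 : ∀ b → (if b then 0 else 0) ≡ 0
if-then-0-else-0 true  = refl
if-then-0-else-0 false = refl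

-- The shared remainder `r` reduces comparing the two sums to comparing single entries at `i`. It
-- serves both weights and neighbourhood sums, since contraction changes the label of `u` alone.
sum-agree-off : ∀ {n} (s t : Vector ℕ n) i → (∀ j → j ≢ i → s j ≡ t j) →
                ∃[ r ] sum s ≡ s i + r × sum t ≡ t i + r
sum-agree-off {suc _} s t i s≡t =
  sum (removeAt s i) , sum-remove s ,
  trans (sum-remove t)
        (cong (t i +_) (sum-cong-≗ (λ j → sym (s≡t _ (Fin.punchInᵢ≢i i j)))))

infixl 6 _⊕_

-- Addition capped at 2, so that the result is again a label.
_⊕_ : Fin 3 → Fin 3 → Fin 3
zero        ⊕ b     = b
suc zero    ⊕ zero  = suc zero
suc zero    ⊕ suc _ = suc (suc zero)
suc (suc _) ⊕ _     = suc (suc zero)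

toℕ-⊕-≤ : ∀ a b → toℕ (a ⊕ b) ≤ toℕ a + toℕ b
toℕ-⊕-≤ zero             b       = ≤-refl
toℕ-⊕-≤ (suc zero)       zero    = ≤-refl
toℕ-⊕-≤ (suc zero)       (suc _) = s≤s (s≤s z≤n)
toℕ-⊕-≤ (suc (suc zero)) b       = s≤s (s≤s z≤n)

-- The cap discards something only when the label is already 2, and then the bound holds whatever
-- `r` is.
⊕-preserves-2≤ : ∀ a b r → 2 ≤ toℕ a + (toℕ b + r) → 2 ≤ toℕ (a ⊕ b) + r
⊕-preserves-2≤ zero          b       r p = p
⊕-preserves-2≤ (suc zero)    zero    r p = p
⊕-preserves-2≤ (suc zero)    (suc _) r p = s≤s (s≤s z≤n)
⊕-preserves-2≤ (suc (suc _)) b       r p = s≤s (s≤s z≤n)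

⊕≡0 : ∀ a b → a ⊕ b ≡ zero → a ≡ zero × b ≡ zero
⊕≡0 zero zero _ = refl , refl
⊕≡0 (suc zero) zero ()
⊕≡0 (suc zero) (suc _) ()
⊕≡0 (suc (suc _)) _ ()

γI-≤-weight : ∀ {n} (G : Graph n) {f} → IsIDF G f → γI G ≤ weight f
γI-≤-weight G {f} idf = proj₂ (γI-isMinimum G) (weight f) (f , idf , refl)

≤∧≤1+⇒≡⊎≡+1 : ∀ {m n} → m ≤ n → n ≤ suc m → n ≡ m ⊎ n ≡ m + 1
≤∧≤1+⇒≡⊎≡+1 {m} m≤n n≤1+m with m≤n⇒m<n∨m≡n m≤n
... | inj₁ m<n = inj₂ (trans (≤-antisym n≤1+m m<n) (+-comm 1 m))
... | inj₂ m≡n = inj₁ (sym m≡n)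

module _ {n} (G : Graph n) (u : Fin n) where

  private
    H : Graph (suc n)
    H = attachTrueTwin G u

  -- The label 1 exempts the twin from the condition, and each old vertex keeps its sum up to a
  -- nonnegative term from the twin.
  extendByOne-isIDF : ∀ {f} → IsIDF G f → IsIDF H (suc zero ∷ f)
  extendByOne-isIDF     idf zero    ()
  extendByOne-isIDF {f} idf (suc v) fv≡0 =
    ≤-trans (idf v fv≡0) (m≤n+m _ (if does (N[]? G u v) then 1 else 0))

  γI-twin-≤ : γI H ≤ suc (γI G)
  γI-twin-≤ with γI-isMinimum G
  ... | (f , idf , w≡γ) , _ =
    subst (λ k → γI H ≤ suc k) w≡γ (γI-≤-weight H (extendByOne-isIDF idf))

  contract : Labelling (suc n) → Labelling n
  contract h = updateAt (h ∘ suc) u (h zero ⊕_)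

  module _ (h : Labelling (suc n)) where

    contract-u : contract h u ≡ h zero ⊕ h (suc u)
    contract-u = updateAt-updates u (h ∘ suc)

    contract-off : ∀ {v} → v ≢ u → contract h v ≡ h (suc v)
    contract-off {v} v≢u = updateAt-minimal v u (h ∘ suc) v≢u

    contract-weight-≤ : weight (contract h) ≤ weight h
    contract-weight-≤
      with sum-agree-off (toℕ ∘ contract h) (toℕ ∘ h ∘ suc) u (λ _ → cong toℕ ∘ contract-off)
    ... | r , g≡ , h≡ = begin
      weight (contract h)                       ≡⟨ g≡ ⟩
      toℕ (contract h u) + r                    ≡⟨ cong (λ x → toℕ x + r) contract-u ⟩
      toℕ (h zero ⊕ h (suc u)) + r              ≤⟨ +-monoˡ-≤ r (toℕ-⊕-≤ (h zero) (h (suc u))) ⟩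
      toℕ (h zero) + toℕ (h (suc u)) + r        ≡⟨ +-assoc (toℕ (h zero)) _ r ⟩
      toℕ (h zero) + (toℕ (h (suc u)) + r)      ≡⟨ cong (toℕ (h zero) +_) (sym h≡) ⟩
      weight h                                  ∎
      where open ≤-Reasoning

    -- The second component is for `u` itself: in `H` it may draw on the label of its twin, which it
    -- no longer sees once the two are merged.
    contract≡0 : ∀ v → contract h v ≡ zero → h (suc v) ≡ zero × (v ≡ u → h zero ≡ zero)
    contract≡0 v gv≡0 with v Fin.≟ u
    ... | no v≢u = trans (sym (contract-off v≢u)) gv≡0 , λ v≡u → contradiction v≡u v≢u
    ... | yes refl with ⊕≡0 (h zero) (h (suc u)) (trans (sym contract-u) gv≡0)
    ...   | h0≡0 , hu≡0 = hu≡0 , λ _ → h0≡0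

    -- A vertex not adjacent to `u` is either `u`, whose twin then has label 0, or lies outside the
    -- closed neighbourhood of `u` and so does not see the twin.
    twin-term≡0 : ∀ v → ¬ Adj G v u → (v ≡ u → h zero ≡ zero) →
                  (if does (N[]? G u v) then toℕ (h zero) else 0) ≡ 0
    twin-term≡0 v ¬vu h0≡0 with v Fin.≟ u
    ... | yes v≡u rewrite h0≡0 v≡u = if-then-0-else-0 _
    ... | no v≢u rewrite dec-false (adj? G u v) (¬vu ∘ symm G) = refl

    contract-isIDF : IsIDF H h → IsIDF G (contract h)
    contract-isIDF idf v gv≡0
      with contract≡0 v gv≡0
    ... | hv≡0 , h0≡0
      with sum-agree-off (λ w → if does (adj? G v w) then toℕ (contract h w) else 0)
                         (λ w → if does (adj? G v w) then toℕ (h (suc w)) else 0) u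
                         (λ w w≢u → cong (λ x → if does (adj? G v w) then toℕ x else 0) (contract-off w≢u))
         | idf (suc v) hv≡0
    -- Both sums now show their entry at `u`, and deciding `adj? G v u` evaluates it in the goal and
    -- in `2≤` at once.
    ... | r , g≡ , h≡ | 2≤ rewrite g≡ | h≡ | contract-u with adj? G v u
    -- The twin contributes at most `toℕ (h zero)`, and this upper bound is enough to merge the two
    -- labels at `u`.
    ...   | yes _  = ⊕-preserves-2≤ (h zero) (h (suc u)) r
                       (≤-trans 2≤ (+-monoˡ-≤ _ (if-else-0-≤ (does (N[]? G u v)) _)))
    -- Neither `u` nor its twin contributes, so the whole sum in `H` comes from `r`, which is
    -- unchanged in `G`.
    ...   | no ¬vu = subst (λ x → 2 ≤ x + r) (twin-term≡0 v ¬vu h0≡0) 2≤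

  γI-≤-twin : γI G ≤ γI H
  γI-≤-twin with γI-isMinimum H
  ... | (h , idf , w≡γ) , _ = subst (γI G ≤_) w≡γ
    (≤-trans (γI-≤-weight G (contract-isIDF h idf)) (contract-weight-≤ h))

theorem3p2 : ∀ {n : ℕ} (G : Graph n) (u : Fin n) →
    γI (attachTrueTwin G u) ≡ γI G ⊎ γI (attachTrueTwin G u) ≡ γI G + 1
theorem3p2 G u = ≤∧≤1+⇒≡⊎≡+1 (γI-≤-twin G u) (γI-twin-≤ G u)
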